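{- Let $Q$ be an $m$-vertex symmetric directed connected graph with multiple edges, and let $p$ be the maximum of the entries of the adjacency matrix of $Q$. Then: (i) Every symmetric directed graph $G$ with no multiple edges such that $Q=G/\bowtie$ for some balanced equivalence relation $\bowtie$ on the vertices of $G$ has $mr$ vertices for some integer $r\geq p$. (ii) For every integer $r\geq p$ there exists a symmetric directed graph $G$ with no multiple edges and with $mr$ vertices, such that $Q=G/\bowtie$ for some balanced equivalence relation $\bowtie$ on the vertices of $G$.
   Context: Directed graphs are finite and may have loops and multiple edges. The adjacency matrix of a directed graph with vertices $1,\ldots,n$ is the $n\times n$ matrix of non-negative integers whose $(i,j)$ entry is the number of directed edges from vertex $j$ to vertex $i$. A directed graph is symmetric (bidirected) if its adjacency matrix is symmetric. A graph has no multiple edges if all entries of its adjacency matrix are $0$ or $1$ (single loops are allowed); it has multiple edges otherwise. A symmetric directed graph is connected if any two of its vertices are joined by a path of edges. An equivalence relation $\bowtie$ on the vertex set of a directed graph $G$ is balanced if, for any two vertices $u,v$ in the same $\bowtie$-class and any $\bowtie$-class $C$, the number of directed edges from vertices of $C$ to $u$ equals the number of directed edges from vertices of $C$ to $v$. For a balanced $\bowtie$ with classes $I_1,\ldots,I_m$, the quotient graph $G/\bowtie$ has one vertex for each class, and its edges are the projections of the edges of $G$: its adjacency matrix $[q_{ij}]_{m\times m}$ is given by letting $q_{ij}$ be the number of directed edges of $G$ from vertices of $I_j$ to any given vertex of $I_i$ (well defined since $\bowtie$ is balanced). The equality $Q=G/\bowtie$ is understood under some labelling of the classes by the vertices of $Q$;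 such a $G$ is called a lift of $Q$. -}

module Defs where

open import Data.Fin using (Fin; _≟_)
open import Data.List using (List; length; filter)
open import Data.List.Membership.Propositional using (_∈_)
open import Data.Nat using (ℕ; _≤_)
open import Data.Product using (_×_; _,_; proj₁; proj₂; ∃₂)
open import Data.Sum using (_⊎_)
open import Function.Bundles using (Bijection)
open import Level using (0ℓ)
open import Relation.Binary using (Rel; Setoid; IsDecEquivalence)
open import Relation.Binary.Construct.Closure.ReflexiveTransitive using (Star)
open import Relation.Binary.PropositionalEquality using (_≡_; setoid)
open import Relation.Nullary using (¬_)
open import Relation.Nullary.Decidable using (_×-dec_)
open import Relation.Unary using (Pred; Decidable)

-- An edge is a pair (source , target); repeated entries of the list are
-- multiple edges, and the order of the list carries no meaning.
record Digraph (n : ℕ) : Set where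
  constructor digraph
  field
    edges : List (Fin n × Fin n)

open Digraph public

module _ {n : ℕ} where

  edgesFrom : Digraph n → {C : Pred (Fin n) 0ℓ} → Decidable C → Fin n → ℕ
  edgesFrom G C? u =
    length (filter (λ e → C? (proj₁ e) ×-dec (proj₂ e ≟ u)) (edges G))

  -- The (i , j) entry counts the edges from j to i.
  adjacency : Digraph n → Fin n → Fin n → ℕ
  adjacency G i j = edgesFrom G (_≟ j) i

  Symmetric : Digraph n → Set
  Symmetric G = ∀ i j → adjacency G i j ≡ adjacency G j i

  NoMultipleEdges : Digraph n → Set
  NoMultipleEdges G = ∀ i j → adjacency G i j ≡ 0 ⊎ adjacency G i j ≡ 1

  HasMultipleEdges : Digraph n → Set
  HasMultipleEdges G = ¬ NoMultipleEdges G

  -- Paths follow edge directions, so this is the usual connectedness only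
  -- for symmetric graphs, the only ones it is used for.
  Connected : Digraph n → Set
  Connected G = ∀ u v → Star (λ x y → (x , y) ∈ edges G) u v

  IsMaximumEntry : ℕ → Digraph n → Set
  IsMaximumEntry p G =
    (∃₂ λ i j → adjacency G i j ≡ p) × (∀ i j → adjacency G i j ≤ p)

-- Equivalence relations are decidable so that the edges leaving a class can be
-- counted; a class is given by any one of its members w, as the predicate _⋈ w.
module _ {n : ℕ} {_⋈_ : Rel (Fin n) 0ℓ} (⋈-isDecEquivalence : IsDecEquivalence _⋈_) where

  open IsDecEquivalence ⋈-isDecEquivalence using (isEquivalence)
    renaming (_≟_ to _⋈?_)

  classSetoid : Setoid 0ℓ 0ℓ
  classSetoid = record { isEquivalence = isEquivalence }

  edgesFromClass : Digraph n → Fin n → Fin n → ℕ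
  edgesFromClass G w u = edgesFrom G (_⋈? w) u

  Balanced : Digraph n → Set
  Balanced G = ∀ {u v} → u ⋈ v → ∀ w → edgesFromClass G w u ≡ edgesFromClass G w v

  -- Q = G/⋈ up to labelling.  A bijection out of classSetoid is a bijection
  -- from the ⋈-classes; the entry of Q for the classes of u and w counts the
  -- edges from the class of w to u.
  record IsQuotient {m : ℕ} (Q : Digraph m) (G : Digraph n) : Set where
    field
      labelling : Bijection classSetoid (setoid (Fin m))
    open Bijection labelling using () renaming (to to label)
    field
      adjacency-quotient :
        ∀ u w → adjacency Q (label u) (label w) ≡ edgesFromClass G w u

record IsLift {m n : ℕ} (Q : Digraph m) (G : Digraph n) : Set₁ where
  field
    _⋈_              : Rel (Fin n) 0ℓ
    isDecEquivalence : IsDecEquivalence _⋈_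
    balanced         : Balanced isDecEquivalence G
    isQuotient       : IsQuotient isDecEquivalence Q G

{-# OPTIONS --safe #-}

-- (i) Counting the edges of G between two classes from either end gives
-- q_ij |I_i| = q_ji |I_j|, so by symmetry and connectedness of Q all classes
-- have the same size r and n = m r.  A vertex receives at most one edge from
-- each vertex of a class, so every entry of Q is at most r.
-- (ii) Join (i , a) and (j , b) in Fin m × Fin r when (a + b) mod r < q_ij.
-- For fixed a the residue (a + b) mod r takes each value below r once, so
-- (i , a) receives exactly q_ij edges from the fibre of j, as q_ij ≤ p ≤ r.
module Submission where

open import Data.Bool using (if_then_else_; true; false)
open import Data.Fin using (Fin; zero; suc; toℕ; inject₁; fromℕ; fromℕ<; _↑ˡ_; _↑ʳ_; combine; quotient; remainder; _≟_)
open import Data.Fin.Properties using (≡-isDecEquivalence; toℕ<n; toℕ-inject₁; toℕ-fromℕ; remQuot-combine)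
open import Data.List using ([]; _∷_; _++_; length; filter; map; tabulate; allFin; cartesianProduct)
open import Data.List.Membership.Propositional using (_∈_)
open import Data.List.Properties using (length-++; filter-++; filter-some)
open import Data.List.Relation.Unary.Any using () renaming (map to Any-map)
open import Data.Nat using (ℕ; zero; suc; _+_; _*_; _≤_; _<_; z≤n; s≤s; _%_; _<?_; NonZero; >-nonZero; >-nonZero⁻¹)
open import Data.Nat.DivMod using ([m+n]%n≡m%n; m<n⇒m%n≡m)
open import Data.Nat.Properties hiding (_≟_; ≡-isDecEquivalence)
open import Data.Product using (_×_; Σ-syntax; _,_; proj₁; proj₂)
open import Data.Sum using (_⊎_; inj₁; inj₂)
open import Function using (_∘_; _⇔_; mk⇔; id)
open import Function.Bundles using (Bijection)
open import Level using (0ℓ)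
open import Relation.Binary using (Rel; IsDecEquivalence) renaming (Decidable to Decidable₂)
open import Relation.Binary.Construct.Closure.ReflexiveTransitive using (Star; ε; _◅_)
import Relation.Binary.Construct.On as On
open import Relation.Binary.PropositionalEquality using (_≡_; refl; sym; trans; cong; cong₂; _≢_; module ≡-Reasoning)
open import Relation.Nullary using (Dec; does; yes; no)
open import Relation.Nullary.Decidable using (_×-dec_; does-⇔)
open import Relation.Unary using (Pred; Decidable)
open import Algebra.Properties.Semiring.Sum +-*-semiring
open import Defs

open ≡-Reasoning

private variable
  A B : Set
  m n r : ℕ

-- Iverson brackets and finite sums.

⟦_⟧ : Dec A → ℕ
⟦ a? ⟧ = if does a? then 1 else 0

⟦⟧-⇔ : A ⇔ B → (a? : Dec A) (b? : Dec B) → ⟦ a? ⟧ ≡ ⟦ b? ⟧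
⟦⟧-⇔ A⇔B a? b? = cong (if_then 1 else 0) (does-⇔ A⇔B a? b?)

⟦×⟧ : (a? : Dec A) (b? : Dec B) → ⟦ a? ×-dec b? ⟧ ≡ ⟦ a? ⟧ * ⟦ b? ⟧
⟦×⟧ a? b? with does a?
... | false = refl
... | true  = sym (+-identityʳ _)

⟦⟧-0∨1 : (a? : Dec A) → ⟦ a? ⟧ ≡ 0 ⊎ ⟦ a? ⟧ ≡ 1
⟦⟧-0∨1 a? with does a?
... | false = inj₁ refl
... | true  = inj₂ refl

*-swap : ∀ a b c → a * (b * c) ≡ b * (a * c)
*-swap a b c = begin
  a * (b * c) ≡⟨ *-assoc a b c ⟨
  a * b * c   ≡⟨ cong (_* c) (*-comm a b) ⟩
  b * a * c   ≡⟨ *-assoc b a c ⟩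
  b * (a * c) ∎

sum-mono : {f g : Fin n → ℕ} → (∀ i → f i ≤ g i) → sum f ≤ sum g
sum-mono {zero}  f≤g = z≤n
sum-mono {suc n} f≤g = +-mono-≤ (f≤g zero) (sum-mono (f≤g ∘ suc))

sum-const : ∀ n k → ∑[ i < n ] k ≡ n * k
sum-const zero    k = refl
sum-const (suc n) k = cong (k +_) (sum-const n k)

sum-≟ : (j : Fin n) (f : Fin n → ℕ) → ∑[ i < n ] (⟦ i ≟ j ⟧ * f i) ≡ f j
sum-≟ {suc n} zero f = begin
  f zero + 0 + ∑[ i < n ] 0 ≡⟨ cong₂ _+_ (+-identityʳ (f zero)) (sum-replicate-zero n) ⟩
  f zero + 0                ≡⟨ +-identityʳ (f zero) ⟩
  f zero                    ∎
-- The brackets compute: the head term is 0 by definition, and the tail is the instance for `j`.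
sum-≟ (suc j) f = sum-≟ j (f ∘ suc)

≟-sym : (i j : Fin n) → ⟦ i ≟ j ⟧ ≡ ⟦ j ≟ i ⟧
≟-sym i j = ⟦⟧-⇔ (mk⇔ sym sym) (i ≟ j) (j ≟ i)

sum-+ : ∀ m (f : Fin (m + n) → ℕ) → sum f ≡ ∑[ i < m ] f (i ↑ˡ n) + ∑[ j < n ] f (m ↑ʳ j)
sum-+ zero    f = refl
sum-+ (suc m) f = trans (cong (f zero +_) (sum-+ m (f ∘ suc))) (sym (+-assoc (f zero) _ _))

sum-combine : ∀ m r (f : Fin (m * r) → ℕ) → sum f ≡ ∑[ i < m ] ∑[ a < r ] f (combine i a)
sum-combine zero    r f = refl
sum-combine (suc m) r f = trans (sum-+ r f) (cong (∑[ a < r ] f (combine {suc m} zero a) +_) (sum-combine m r (f ∘ (r ↑ʳ_))))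

-- Both sides are the sum of `g` over 0, ..., `r`, split off at the first or at the last term. The
-- additive form avoids truncated subtraction.
sum-shift : ∀ r (g : ℕ → ℕ) → ∑[ b < r ] g (suc (toℕ b)) + g 0 ≡ ∑[ b < r ] g (toℕ b) + g r
sum-shift r g = begin
  ∑[ b < r ] g (suc (toℕ b)) + g 0                  ≡⟨ +-comm _ (g 0) ⟩
  ∑[ b < suc r ] g (toℕ b)                          ≡⟨ sum-init-last {r} (g ∘ toℕ) ⟩
  ∑[ b < r ] g (toℕ (inject₁ b)) + g (toℕ (fromℕ r)) ≡⟨ cong₂ _+_ (sum-cong-≗ {r} (cong g ∘ toℕ-inject₁)) (cong g (toℕ-fromℕ r)) ⟩
  ∑[ b < r ] g (toℕ b) + g r                        ∎

-- Moving the window from `a` to `suc a` drops `g a` and gains `g (a + r)`, which agree by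
-- periodicity.
sum-periodic : ∀ r (g : ℕ → ℕ) → (∀ k → g (k + r) ≡ g k) →
               ∀ a → ∑[ b < r ] g (a + toℕ b) ≡ ∑[ b < r ] g (toℕ b)
sum-periodic r g periodic zero    = refl
sum-periodic r g periodic (suc a) = trans
  (+-cancelʳ-≡ (g a) _ _ (begin
    ∑[ b < r ] g (suc a + toℕ b) + g a          ≡⟨ cong₂ _+_ (sum-cong-≗ {r} λ b → cong g (sym (+-suc a (toℕ b)))) (cong g (sym (+-identityʳ a))) ⟩
    ∑[ b < r ] g (a + suc (toℕ b)) + g (a + 0)  ≡⟨ sum-shift r (g ∘ (a +_)) ⟩
    ∑[ b < r ] g (a + toℕ b) + g (a + r)        ≡⟨ cong (∑[ b < r ] g (a + toℕ b) +_) (periodic a) ⟩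
    ∑[ b < r ] g (a + toℕ b) + g a              ∎))
  (sum-periodic r g periodic a)

-- Each `s≤s` peels off one position that counts; once the bound is 0, none does.
sum-< : ∀ {q r} → q ≤ r → ∑[ b < r ] ⟦ toℕ b <? q ⟧ ≡ q
sum-< {r = r} z≤n = sum-replicate-zero r
sum-< (s≤s q≤r)   = cong suc (sum-< q≤r)

-- Periodicity removes the shift by `a`. What remains is an initial segment of length `q`, which
-- fits into the range because `q ≤ r`.
sum-%< : ∀ {q r} .{{_ : NonZero r}} → q ≤ r → ∀ a → ∑[ b < r ] ⟦ (a + toℕ b) % r <? q ⟧ ≡ q
sum-%< {q} {r} q≤r a = begin
  ∑[ b < r ] ⟦ (a + toℕ b) % r <? q ⟧ ≡⟨ sum-periodic r (λ k → ⟦ k % r <? q ⟧) (λ k → cong (λ k → ⟦ k <? q ⟧) ([m+n]%n≡m%n k r)) a ⟩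
  ∑[ b < r ] ⟦ toℕ b % r <? q ⟧       ≡⟨ sum-cong-≗ {r} (λ b → cong (λ k → ⟦ k <? q ⟧) (m<n⇒m%n≡m (toℕ<n b))) ⟩
  ∑[ b < r ] ⟦ toℕ b <? q ⟧           ≡⟨ sum-< q≤r ⟩
  q                                   ∎

-- Counting in filtered lists.

module _ {P : Pred A 0ℓ} (P? : Decidable P) where

  length-filter-∷ : ∀ x xs → length (filter P? (x ∷ xs)) ≡ ⟦ P? x ⟧ + length (filter P? xs)
  length-filter-∷ x xs with does (P? x)
  ... | false = refl
  ... | true  = refl

  length-filter-map : (f : B → A) → ∀ xs → length (filter P? (map f xs)) ≡ length (filter (P? ∘ f) xs)
  length-filter-map f []       = refl
  length-filter-map f (x ∷ xs) with does (P? (f x))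
  ... | false = length-filter-map f xs
  ... | true  = cong suc (length-filter-map f xs)

  length-filter-tabulate : ∀ n (f : Fin n → A) → length (filter P? (tabulate f)) ≡ ∑[ i < n ] ⟦ P? (f i) ⟧
  length-filter-tabulate zero    f = refl
  length-filter-tabulate (suc n) f =
    trans (length-filter-∷ (f zero) _) (cong (⟦ P? (f zero) ⟧ +_) (length-filter-tabulate n (f ∘ suc)))

  -- Merges the filter that builds a graph from a relation with the filter that counts its edges.
  filter-filter : {R : Pred A 0ℓ} (R? : Decidable R) → ∀ xs →
                  filter P? (filter R? xs) ≡ filter (λ x → R? x ×-dec P? x) xs
  filter-filter R? []       = refl
  filter-filter R? (x ∷ xs) with does (R? x)
  ... | false = filter-filter R? xs
  ... | true with does (P? x)
  ...   | false = filter-filter R? xs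
  ...   | true  = cong (x ∷_) (filter-filter R? xs)

-- Arbitrary `f` and `g` in place of `allFin` let the induction pass from `f` to `f ∘ suc`.
length-filter-cartesianProduct : {P : Pred (A × B) 0ℓ} (P? : Decidable P) (f : Fin n → A) (g : Fin m → B) →
  length (filter P? (cartesianProduct (tabulate f) (tabulate g))) ≡ ∑[ i < n ] ∑[ j < m ] ⟦ P? (f i , g j) ⟧
length-filter-cartesianProduct {n = zero}  P? f g = refl
length-filter-cartesianProduct {n = suc n} {m = m} P? f g = begin
  length (filter P? (row ++ rest))                      ≡⟨ cong length (filter-++ P? row rest) ⟩
  length (filter P? row ++ filter P? rest)              ≡⟨ length-++ (filter P? row) ⟩
  length (filter P? row) + length (filter P? rest)      ≡⟨ cong₂ _+_ count-row (length-filter-cartesianProduct P? (f ∘ suc) g) ⟩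
  ∑[ i < suc n ] ∑[ j < m ] ⟦ P? (f i , g j) ⟧          ∎
  where
  row  = map (f zero ,_) (tabulate g)
  rest = cartesianProduct (tabulate (f ∘ suc)) (tabulate g)
  count-row = trans (length-filter-map P? (f zero ,_) (tabulate g))
                    (length-filter-tabulate (P? ∘ (f zero ,_)) m g)

-- Edge counts in terms of the adjacency matrix.

edgesFrom-∷ : ∀ (x y : Fin n) es {C : Pred (Fin n) 0ℓ} (C? : Decidable C) u →
  edgesFrom (digraph ((x , y) ∷ es)) C? u ≡ ⟦ C? x ⟧ * ⟦ y ≟ u ⟧ + edgesFrom (digraph es) C? u
edgesFrom-∷ x y es C? u = trans
  (length-filter-∷ (λ e → C? (proj₁ e) ×-dec (proj₂ e ≟ u)) (x , y) es)
  (cong (_+ edgesFrom (digraph es) C? u) (⟦×⟧ (C? x) (y ≟ u)))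

-- Sort the edges into `u` by their source. In the induction, a new edge affects only the term of
-- its own source `s`, so `sum-≟` read backwards spreads its contribution over all `x`.
edgesFrom-adjacency : ∀ es {C : Pred (Fin n) 0ℓ} (C? : Decidable C) u →
  edgesFrom (digraph es) C? u ≡ ∑[ x < n ] (⟦ C? x ⟧ * adjacency (digraph es) u x)
edgesFrom-adjacency {n} [] C? u = sym
  (trans (sum-cong-≗ {n} (λ x → *-zeroʳ ⟦ C? x ⟧)) (sum-replicate-zero n))
edgesFrom-adjacency {n} ((s , t) ∷ es) C? u = begin
  edgesFrom (digraph ((s , t) ∷ es)) C? u
    ≡⟨ edgesFrom-∷ s t es C? u ⟩
  ⟦ C? s ⟧ * ⟦ t ≟ u ⟧ + edgesFrom G′ C? u
    ≡⟨ cong₂ _+_ (sym (sum-≟ s (λ x → ⟦ C? x ⟧ * ⟦ t ≟ u ⟧))) (edgesFrom-adjacency es C? u) ⟩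
  ∑[ x < n ] (⟦ x ≟ s ⟧ * (⟦ C? x ⟧ * ⟦ t ≟ u ⟧)) + ∑[ x < n ] (⟦ C? x ⟧ * adjacency G′ u x)
    ≡⟨ ∑-distrib-+ {n} _ _ ⟨
  ∑[ x < n ] (⟦ x ≟ s ⟧ * (⟦ C? x ⟧ * ⟦ t ≟ u ⟧) + ⟦ C? x ⟧ * adjacency G′ u x)
    ≡⟨ sum-cong-≗ {n} step ⟩
  ∑[ x < n ] (⟦ C? x ⟧ * adjacency (digraph ((s , t) ∷ es)) u x) ∎
  where
  G′ = digraph es
  step : ∀ x → ⟦ x ≟ s ⟧ * (⟦ C? x ⟧ * ⟦ t ≟ u ⟧) + ⟦ C? x ⟧ * adjacency G′ u x
             ≡ ⟦ C? x ⟧ * adjacency (digraph ((s , t) ∷ es)) u x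
  step x = begin
    ⟦ x ≟ s ⟧ * (⟦ C? x ⟧ * ⟦ t ≟ u ⟧) + ⟦ C? x ⟧ * adjacency G′ u x
      ≡⟨ cong (_+ ⟦ C? x ⟧ * adjacency G′ u x) (trans (*-swap ⟦ x ≟ s ⟧ ⟦ C? x ⟧ ⟦ t ≟ u ⟧)
           (cong (λ k → ⟦ C? x ⟧ * (k * ⟦ t ≟ u ⟧)) (≟-sym x s))) ⟩
    ⟦ C? x ⟧ * (⟦ s ≟ x ⟧ * ⟦ t ≟ u ⟧) + ⟦ C? x ⟧ * adjacency G′ u x
      ≡⟨ *-distribˡ-+ ⟦ C? x ⟧ _ _ ⟨
    ⟦ C? x ⟧ * (⟦ s ≟ x ⟧ * ⟦ t ≟ u ⟧ + adjacency G′ u x)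
      ≡⟨ cong (⟦ C? x ⟧ *_) (edgesFrom-∷ s t es (_≟ x) u) ⟨
    ⟦ C? x ⟧ * adjacency (digraph ((s , t) ∷ es)) u x ∎

edge⇒adjacency>0 : ∀ (G : Digraph n) {x y} → (x , y) ∈ edges G → 0 < adjacency G y x
edge⇒adjacency>0 G {x} {y} e∈ =
  filter-some (λ e → (proj₁ e ≟ x) ×-dec (proj₂ e ≟ y)) (Any-map (λ { refl → refl , refl }) e∈)

-- Class sizes of a lift.

module LiftSize {Q : Digraph m} {G : Digraph n} (Q-sym : Symmetric Q) (Q-conn : Connected Q)
                (G-sym : Symmetric G) (G-simple : NoMultipleEdges G) (lift : IsLift Q G) where

  open IsLift lift
  open IsQuotient isQuotient
  open Bijection labelling using (injective; strictlySurjective)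
    renaming (to to label; cong to label-cong)
  open IsDecEquivalence isDecEquivalence using () renaming (_≟_ to _⋈?_)

  inClass : Fin m → Fin n → ℕ
  inClass j x = ⟦ label x ≟ j ⟧

  classSize : Fin m → ℕ
  classSize j = ∑[ x < n ] inClass j x

  -- Surjectivity of the labelling supplies a representative `w` of the class `j`; injectivity lets
  -- equality of labels replace `_⋈ w`.
  quotient-entry : ∀ u j → adjacency Q (label u) j ≡ ∑[ x < n ] (inClass j x * adjacency G u x)
  quotient-entry u j with strictlySurjective j
  ... | w , refl = begin
    adjacency Q (label u) (label w)                ≡⟨ adjacency-quotient u w ⟩
    edgesFrom G (_⋈? w) u                          ≡⟨ edgesFrom-adjacency (edges G) (_⋈? w) u ⟩
    ∑[ x < n ] (⟦ x ⋈? w ⟧ * adjacency G u x)      ≡⟨ sum-cong-≗ {n} (λ x → cong (_* adjacency G u x)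
                                                        (⟦⟧-⇔ (mk⇔ label-cong injective) (x ⋈? w) (label x ≟ label w))) ⟩
    ∑[ x < n ] (inClass (label w) x * adjacency G u x) ∎

  -- The double sum counts the edges of `G` from class `j` to class `i`. Grouped by target, each of
  -- the `classSize i` targets receives the same number.
  edgesBetween : ∀ i j → ∑[ u < n ] ∑[ x < n ] (inClass i u * (inClass j x * adjacency G u x))
                       ≡ classSize i * adjacency Q i j
  edgesBetween i j = begin
    ∑[ u < n ] ∑[ x < n ] (inClass i u * (inClass j x * adjacency G u x))
      ≡⟨ sum-cong-≗ {n} (λ u → sym (*-distribˡ-sum {n} (inClass i u) _)) ⟩
    ∑[ u < n ] (inClass i u * ∑[ x < n ] (inClass j x * adjacency G u x))
      ≡⟨ sum-cong-≗ {n} (λ u → trans (cong (inClass i u *_) (sym (quotient-entry u j))) (relabel u)) ⟩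
    ∑[ u < n ] (inClass i u * adjacency Q i j)
      ≡⟨ *-distribʳ-sum {n} (adjacency Q i j) (inClass i) ⟨
    classSize i * adjacency Q i j ∎
    where
    -- Outside class `i` both sides have the factor 0.
    relabel : ∀ u → inClass i u * adjacency Q (label u) j ≡ inClass i u * adjacency Q i j
    relabel u with label u ≟ i
    ... | yes refl = refl
    ... | no _     = refl

  -- Exchanging the sums groups the same edges by source, and symmetry of `G` reverses each of them.
  edgesBetween-comm : ∀ i j → classSize i * adjacency Q i j ≡ classSize j * adjacency Q j i
  edgesBetween-comm i j = begin
    classSize i * adjacency Q i j
      ≡⟨ edgesBetween i j ⟨
    ∑[ u < n ] ∑[ x < n ] (inClass i u * (inClass j x * adjacency G u x))
      ≡⟨ ∑-comm {n} {n} _ ⟩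
    ∑[ x < n ] ∑[ u < n ] (inClass i u * (inClass j x * adjacency G u x))
      ≡⟨ sum-cong-≗ {n} (λ x → sum-cong-≗ {n} λ u → trans (*-swap (inClass i u) (inClass j x) _)
           (cong (λ k → inClass j x * (inClass i u * k)) (G-sym u x))) ⟩
    ∑[ x < n ] ∑[ u < n ] (inClass j x * (inClass i u * adjacency G x u))
      ≡⟨ edgesBetween j i ⟩
    classSize j * adjacency Q j i ∎

  -- By symmetry of `Q` both products have the same entry as a factor; the edge makes it positive,
  -- so it cancels.
  classSize-edge : ∀ {i j} → (i , j) ∈ edges Q → classSize i ≡ classSize j
  classSize-edge {i} {j} e∈ = *-cancelʳ-≡ _ _ (adjacency Q j i) {{>-nonZero (edge⇒adjacency>0 Q e∈)}}
    (trans (cong (classSize i *_) (Q-sym j i)) (edgesBetween-comm i j))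

  classSize-path : ∀ {i j} → Star (λ x y → (x , y) ∈ edges Q) i j → classSize i ≡ classSize j
  classSize-path ε        = refl
  classSize-path (e ◅ es) = trans (classSize-edge e) (classSize-path es)

  -- Each vertex has exactly one label, so it is counted in exactly one class.
  sum-classSize : n ≡ ∑[ i < m ] classSize i
  sum-classSize = begin
    n                                     ≡⟨ *-identityʳ n ⟨
    n * 1                                 ≡⟨ sum-const n 1 ⟨
    ∑[ u < n ] 1                          ≡⟨ sum-cong-≗ {n} (λ u → sum-≟ (label u) (λ _ → 1)) ⟨
    ∑[ u < n ] ∑[ i < m ] (⟦ i ≟ label u ⟧ * 1) ≡⟨ sum-cong-≗ {n} (λ u → sum-cong-≗ {m} λ i →
                                               trans (*-identityʳ _) (≟-sym i (label u))) ⟩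
    ∑[ u < n ] ∑[ i < m ] inClass i u     ≡⟨ ∑-comm {n} {m} _ ⟩
    ∑[ i < m ] classSize i                ∎

  size : ∀ j → n ≡ m * classSize j
  size j = begin
    n                      ≡⟨ sum-classSize ⟩
    ∑[ i < m ] classSize i ≡⟨ sum-cong-≗ {m} (λ i → classSize-path (Q-conn i j)) ⟩
    ∑[ i < m ] classSize j ≡⟨ sum-const m (classSize j) ⟩
    m * classSize j        ∎

  -- A vertex `u` of class `i` receives at most one edge from each member of class `j`.
  entry≤classSize : ∀ i j → adjacency Q i j ≤ classSize j
  entry≤classSize i j with strictlySurjective i
  ... | u , refl = ≤-trans (≤-reflexive (quotient-entry u j)) (sum-mono {n} λ x →
    ≤-trans (*-monoʳ-≤ (inClass j x) (adjacency≤1 u x)) (≤-reflexive (*-identityʳ _)))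
    where
    adjacency≤1 : ∀ u x → adjacency G u x ≤ 1
    adjacency≤1 u x with G-simple u x
    ... | inj₁ ≡0 = ≤-trans (≤-reflexive ≡0) z≤n
    ... | inj₂ ≡1 = ≤-reflexive ≡1

-- Graphs of decidable relations.

fromRelation : {R : Rel (Fin n) 0ℓ} → Decidable₂ R → Digraph n
fromRelation {n} R? = digraph (filter (λ e → R? (proj₁ e) (proj₂ e)) (cartesianProduct (allFin n) (allFin n)))

-- The pair `(j , i)` occurs once among all pairs, so two brackets collapse the double sum. The
-- arguments swap because edges list the source first and matrix entries the target first.
adjacency-fromRelation : ∀ {R : Rel (Fin n) 0ℓ} (R? : Decidable₂ R) i j →
  adjacency (fromRelation R?) i j ≡ ⟦ R? j i ⟧
adjacency-fromRelation {n} R? i j = begin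
  adjacency (fromRelation R?) i j
    ≡⟨ cong length (filter-filter P? R′? pairs) ⟩
  length (filter (λ e → R′? e ×-dec P? e) pairs)
    ≡⟨ length-filter-cartesianProduct (λ e → R′? e ×-dec P? e) id id ⟩
  ∑[ x < n ] ∑[ y < n ] ⟦ R? x y ×-dec ((x ≟ j) ×-dec (y ≟ i)) ⟧
    ≡⟨ sum-cong-≗ {n} (λ x → sum-cong-≗ {n} (λ y → rearrange x y)) ⟩
  ∑[ x < n ] ∑[ y < n ] (⟦ y ≟ i ⟧ * (⟦ x ≟ j ⟧ * ⟦ R? x y ⟧))
    ≡⟨ sum-cong-≗ {n} (λ x → sum-≟ i (λ y → ⟦ x ≟ j ⟧ * ⟦ R? x y ⟧)) ⟩
  ∑[ x < n ] (⟦ x ≟ j ⟧ * ⟦ R? x i ⟧)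
    ≡⟨ sum-≟ j (λ x → ⟦ R? x i ⟧) ⟩
  ⟦ R? j i ⟧ ∎
  where
  pairs = cartesianProduct (allFin n) (allFin n)
  P? = λ (e : Fin n × Fin n) → (proj₁ e ≟ j) ×-dec (proj₂ e ≟ i)
  R′? = λ (e : Fin n × Fin n) → R? (proj₁ e) (proj₂ e)
  rearrange : ∀ x y → ⟦ R? x y ×-dec ((x ≟ j) ×-dec (y ≟ i)) ⟧ ≡ ⟦ y ≟ i ⟧ * (⟦ x ≟ j ⟧ * ⟦ R? x y ⟧)
  rearrange x y = begin
    ⟦ R? x y ×-dec ((x ≟ j) ×-dec (y ≟ i)) ⟧   ≡⟨ ⟦×⟧ (R? x y) ((x ≟ j) ×-dec (y ≟ i)) ⟩
    ⟦ R? x y ⟧ * ⟦ (x ≟ j) ×-dec (y ≟ i) ⟧     ≡⟨ cong (⟦ R? x y ⟧ *_) (⟦×⟧ (x ≟ j) (y ≟ i)) ⟩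
    ⟦ R? x y ⟧ * (⟦ x ≟ j ⟧ * ⟦ y ≟ i ⟧)       ≡⟨ *-comm ⟦ R? x y ⟧ _ ⟩
    ⟦ x ≟ j ⟧ * ⟦ y ≟ i ⟧ * ⟦ R? x y ⟧         ≡⟨ *-assoc ⟦ x ≟ j ⟧ _ _ ⟩
    ⟦ x ≟ j ⟧ * (⟦ y ≟ i ⟧ * ⟦ R? x y ⟧)       ≡⟨ *-swap ⟦ x ≟ j ⟧ ⟦ y ≟ i ⟧ _ ⟩
    ⟦ y ≟ i ⟧ * (⟦ x ≟ j ⟧ * ⟦ R? x y ⟧)       ∎

-- A lift with fibres of size `r`.

module CirculantLift (Q : Digraph m) (Q-sym : Symmetric Q) (r : ℕ) .{{r≢0 : NonZero r}}
                     (bounded : ∀ i j → adjacency Q i j ≤ r) where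

  label : Fin (m * r) → Fin m
  label = quotient r

  position : Fin (m * r) → Fin r
  position = remainder {m} r

  -- Each block of the adjacency matrix is anti-circulant. The sum of the positions, unlike their
  -- difference, is unchanged when the endpoints are swapped, which makes the graph symmetric.
  Joined : Rel (Fin (m * r)) 0ℓ
  Joined x y = (toℕ (position y) + toℕ (position x)) % r < adjacency Q (label y) (label x)

  joined? : Decidable₂ Joined
  joined? x y = (toℕ (position y) + toℕ (position x)) % r <? adjacency Q (label y) (label x)

  joined-sym : ∀ {x y} → Joined x y → Joined y x
  joined-sym {x} {y} xy rewrite +-comm (toℕ (position y)) (toℕ (position x)) | Q-sym (label y) (label x) = xy

  graph : Digraph (m * r)
  graph = fromRelation joined?

  graph-sym : Symmetric graph
  graph-sym x y = begin
    adjacency graph x y ≡⟨ adjacency-fromRelation joined? x y ⟩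
    ⟦ joined? y x ⟧     ≡⟨ ⟦⟧-⇔ (mk⇔ joined-sym joined-sym) (joined? y x) (joined? x y) ⟩
    ⟦ joined? x y ⟧     ≡⟨ adjacency-fromRelation joined? y x ⟨
    adjacency graph y x ∎

  graph-simple : NoMultipleEdges graph
  graph-simple x y rewrite adjacency-fromRelation joined? x y = ⟦⟧-0∨1 (joined? y x)

  sameLabel : IsDecEquivalence (λ x y → label x ≡ label y)
  sameLabel = On.isDecEquivalence label ≡-isDecEquivalence

  -- The count depends on `u` and `w` through their labels only, which yields both balance and the
  -- quotient matrix.
  edgesFromFibre : ∀ u w → edgesFromClass sameLabel graph w u ≡ adjacency Q (label u) (label w)
  edgesFromFibre u w = begin
    edgesFromClass sameLabel graph w u
      ≡⟨ edgesFrom-adjacency (edges graph) (λ x → label x ≟ label w) u ⟩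
    ∑[ x < m * r ] (⟦ label x ≟ label w ⟧ * adjacency graph u x)
      ≡⟨ sum-cong-≗ {m * r} (λ x → cong (⟦ label x ≟ label w ⟧ *_) (adjacency-fromRelation joined? u x)) ⟩
    ∑[ x < m * r ] (⟦ label x ≟ label w ⟧ * ⟦ joined? x u ⟧)
      ≡⟨ sum-combine m r _ ⟩
    ∑[ i < m ] ∑[ b < r ] (⟦ label (combine i b) ≟ label w ⟧ * ⟦ joined? (combine i b) u ⟧)
      -- `label` and `position` are the two projections of `remQuot`, so rewriting the pair
      -- evaluates both at `combine i b`.
      ≡⟨ sum-cong-≗ {m} (λ i → sum-cong-≗ {r} (λ b → cong
           (λ ib → ⟦ proj₁ ib ≟ label w ⟧ * ⟦ (toℕ (position u) + toℕ (proj₂ ib)) % r <? adjacency Q (label u) (proj₁ ib) ⟧)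
           (remQuot-combine {m} {r} i b))) ⟩
    ∑[ i < m ] ∑[ b < r ] (⟦ i ≟ label w ⟧ * below i b)
      ≡⟨ sum-cong-≗ {m} (λ i → sym (*-distribˡ-sum {r} ⟦ i ≟ label w ⟧ (below i))) ⟩
    ∑[ i < m ] (⟦ i ≟ label w ⟧ * ∑[ b < r ] below i b)
      ≡⟨ sum-≟ (label w) (λ i → ∑[ b < r ] below i b) ⟩
    ∑[ b < r ] below (label w) b
      ≡⟨ sum-%< (bounded (label u) (label w)) (toℕ (position u)) ⟩
    adjacency Q (label u) (label w) ∎
    where
    below : Fin m → Fin r → ℕ
    below i b = ⟦ (toℕ (position u) + toℕ b) % r <? adjacency Q (label u) i ⟧

  graph-lift : IsLift Q graph
  graph-lift = record
    { isDecEquivalence = sameLabel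
    ; balanced = λ {u} {v} u⋈v w → trans (edgesFromFibre u w)
        (trans (cong (λ i → adjacency Q i (label w)) u⋈v) (sym (edgesFromFibre v w)))
    ; isQuotient = record
      { labelling = record
        { to        = label
        ; cong      = id
        -- Equivalence is equality of labels, so injectivity is `id`. Position 0 of each fibre
        -- witnesses surjectivity; it exists since `r` is nonzero.
        ; bijective = id , λ i → combine i zeroᵣ , λ z≡ → trans z≡ (cong proj₁ (remQuot-combine i zeroᵣ))
        }
      ; adjacency-quotient = λ u w → sym (edgesFromFibre u w)
      }
    }
    where
    zeroᵣ : Fin r
    zeroᵣ = fromℕ< (>-nonZero⁻¹ r)

theorem2p10 : ∀ (m : ℕ) (Q : Digraph m) (p : ℕ) →
    Symmetric Q → Connected Q → HasMultipleEdges Q → IsMaximumEntry p Q →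
    (∀ (n : ℕ) (G : Digraph n) → Symmetric G → NoMultipleEdges G → IsLift Q G →
    Σ[ r ∈ ℕ ] (p ≤ r × n ≡ m * r))
    ×
    (∀ (r : ℕ) → p ≤ r →
    Σ[ G ∈ Digraph (m * r) ] (Symmetric G × NoMultipleEdges G × IsLift Q G))
theorem2p10 m Q p Q-sym Q-conn Q-multi ((i , j , refl) , max) = lift-size , lift-exists
  where
  lift-size : ∀ n (G : Digraph n) → Symmetric G → NoMultipleEdges G → IsLift Q G →
              Σ[ r ∈ ℕ ] (p ≤ r × n ≡ m * r)
  -- All classes have equal size; taking the column `j` of a maximal entry makes the bound on that
  -- entry read `p ≤ r`.
  lift-size n G G-sym G-simple lift = classSize j , entry≤classSize i j , size j
    where open LiftSize Q-sym Q-conn G-sym G-simple lift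

  -- If `p` were 0, all entries would be 0 and `Q` would have no multiple edges. Hence `r` is
  -- positive and residues modulo `r` make sense.
  p≢0 : p ≢ 0
  p≢0 p≡0 = Q-multi λ k l → inj₁ (n≤0⇒n≡0 (≤-trans (max k l) (≤-reflexive p≡0)))

  lift-exists : ∀ r → p ≤ r → Σ[ G ∈ Digraph (m * r) ] (Symmetric G × NoMultipleEdges G × IsLift Q G)
  lift-exists r p≤r = graph , graph-sym , graph-simple , graph-lift
    where
    instance
      r≢0 : NonZero r
      r≢0 = >-nonZero (<-≤-trans (n≢0⇒n>0 p≢0) p≤r)
    open CirculantLift Q Q-sym r (λ k l → ≤-trans (max k l) p≤r)
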